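{- Let $m\in\mathbb{N}$ be odd and write $m=2k+1$. Then the friendship graph $F_{\lfloor m/2\rfloor}=F_k$ is $\mathbb{Z}_m$-cordial.
   Context: Graphs are finite, simple and undirected. For $n\in\mathbb{N}$, the friendship graph $F_n$ is the union of $n$ copies of the triangle $C_3$ joined at a single common (central) vertex. For an abelian group $A$ and a graph $G=(V,E)$, a vertex labeling $\ell:V\to A$ induces an edge labeling $\ell(\{v_1,v_2\})=\ell(v_1)+\ell(v_2)$. Let $f_V(a)=|\{v\in V:\ell(v)=a\}|$ and $f_E(a)=|\{e\in E:\ell(e)=a\}|$. The labeling is $A$-cordial if $|f_V(a_1)-f_V(a_2)|\le 1$ and $|f_E(a_1)-f_E(a_2)|\le 1$ for all $a_1,a_2\in A$; $G$ is $A$-cordial if it admits an $A$-cordial labeling. -}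

module Defs where

open import Algebra.Bundles using (AbelianGroup)
open import Data.Fin.Base using (Fin)
open import Data.Integer.Base as ℤ using (ℤ; +_; 0ℤ)
open import Data.Integer.Divisibility.Signed
  using (_∣_; divides; _∣?_; ∣m⇒∣-m; ∣m∣n⇒∣m+n)
import Data.Integer.Properties as ℤ
open import Data.Integer.Tactic.RingSolver using (solve-∀)
open import Data.List.Base using (List; []; _∷_; concat; filter; length; tabulate)
open import Data.List.Membership.Propositional using (_∈_)
open import Data.List.Membership.Propositional.Properties using (∈-concat⁺′; ∈-tabulate⁺)
open import Data.List.Relation.Unary.All using (All; []; _∷_)
import Data.List.Relation.Unary.All.Properties as All
open import Data.List.Relation.Unary.AllPairs using (AllPairs; []; _∷_)
import Data.List.Relation.Unary.AllPairs.Properties as AllPairs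
open import Data.List.Relation.Unary.Any using (here; there)
open import Data.List.Relation.Unary.Unique.Propositional using (Unique)
open import Data.Nat.Base as ℕ using (ℕ; ∣_-_∣)
open import Data.Product.Base using (_×_; _,_; ∃)
open import Data.Sum.Base using (_⊎_; inj₁; inj₂)
open import Level using (Level; 0ℓ; _⊔_)
open import Relation.Binary.Core using (Rel)
open import Relation.Binary.Definitions using (Decidable)
open import Relation.Binary.PropositionalEquality
  using (_≡_; _≢_; refl; subst)
open import Relation.Nullary.Negation using (¬_)

-- (u , v) and (x , y) denote the same unordered pair.
SamePair : {V : Set} → Rel (V × V) 0ℓ
SamePair (u , v) (x , y) = (u ≡ x × v ≡ y) ⊎ (u ≡ y × v ≡ x)

-- Finite simple undirected graphs.  The vertex type is finite because it is
-- exhaustively enumerated; an edge {u , v} is listed once, as one of the pairs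
-- (u , v) and (v , u).  As neither list has repetitions, their lengths, and
-- those of their filtrations, are cardinalities.
record Graph : Set₁ where
  field
    Vertex          : Set
    vertices        : List Vertex
    vertices-all    : ∀ v → v ∈ vertices
    vertices-unique : Unique vertices
    edges           : List (Vertex × Vertex)
    edges-loopless  : All (λ (u , v) → u ≢ v) edges
    edges-unique    : AllPairs (λ e f → ¬ SamePair e f) edges

-- Groups are setoids here, so "ℓ(v) = a" is ℓ v ≈ a; it is assumed decidable
-- only so that its solutions can be counted.
module _ {c ℓ : Level} (A : AbelianGroup c ℓ)
         (_≈?_ : Decidable (AbelianGroup._≈_ A)) (G : Graph) where

  open AbelianGroup A using (Carrier; _∙_)
  open Graph G

  Labeling : Set c
  Labeling = Vertex → Carrier

  -- Well defined on unordered pairs, since A is commutative.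
  edgeLabel : Labeling → Vertex × Vertex → Carrier
  edgeLabel l (u , v) = l u ∙ l v

  vertexCount : Labeling → Carrier → ℕ
  vertexCount l a = length (filter (λ v → l v ≈? a) vertices)

  edgeCount : Labeling → Carrier → ℕ
  edgeCount l a = length (filter (λ e → edgeLabel l e ≈? a) edges)

  record IsCordialLabeling (l : Labeling) : Set c where
    field
      vertices-balanced : ∀ a₁ a₂ → ∣ vertexCount l a₁ - vertexCount l a₂ ∣ ℕ.≤ 1
      edges-balanced    : ∀ a₁ a₂ → ∣ edgeCount l a₁ - edgeCount l a₂ ∣ ℕ.≤ 1

  Cordial : Set c
  Cordial = ∃ IsCordialLabeling

-- ℤ/mℤ, as the integers under congruence modulo m.
module _ (m : ℕ) where

  infix 4 _≡ₘ_

  _≡ₘ_ : Rel ℤ 0ℓ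
  a ≡ₘ b = + m ∣ a ℤ.- b

  _≡ₘ?_ : Decidable _≡ₘ_
  a ≡ₘ? b = + m ∣? a ℤ.- b

  private
    reflexive : ∀ {a b} → a ≡ b → a ≡ₘ b
    reflexive {a} refl = divides 0ℤ (ℤ.+-inverseʳ a)

    neg-diff : ∀ a b → ℤ.- (a ℤ.- b) ≡ b ℤ.- a
    neg-diff = solve-∀

    add-diff : ∀ a b c → (a ℤ.- b) ℤ.+ (b ℤ.- c) ≡ a ℤ.- c
    add-diff = solve-∀

    diff-add : ∀ a b c d → (a ℤ.- b) ℤ.+ (c ℤ.- d) ≡ (a ℤ.+ c) ℤ.- (b ℤ.+ d)
    diff-add = solve-∀

    diff-neg : ∀ a b → ℤ.- (a ℤ.- b) ≡ ℤ.- a ℤ.- ℤ.- b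
    diff-neg = solve-∀

  ℤ/ : AbelianGroup 0ℓ 0ℓ
  ℤ/ = record
    { Carrier = ℤ
    ; _≈_ = _≡ₘ_
    ; _∙_ = ℤ._+_
    ; ε = 0ℤ
    ; _⁻¹ = ℤ.-_
    ; isAbelianGroup = record
      { isGroup = record
        { isMonoid = record
          { isSemigroup = record
            { isMagma = record
              { isEquivalence = record
                { refl  = λ {a} → reflexive {a} refl
                ; sym   = λ {a b} p → subst (+ m ∣_) (neg-diff a b) (∣m⇒∣-m p)
                ; trans = λ {a b c} p q → subst (+ m ∣_) (add-diff a b c) (∣m∣n⇒∣m+n p q)
                }
              ; ∙-cong = λ {a b c d} p q → subst (+ m ∣_) (diff-add a b c d) (∣m∣n⇒∣m+n p q)
              }
            ; assoc = λ a b c → reflexive (ℤ.+-assoc a b c)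
            }
          ; identity = (λ a → reflexive (ℤ.+-identityˡ a)) , (λ a → reflexive (ℤ.+-identityʳ a))
          }
        ; inverse = (λ a → reflexive (ℤ.+-inverseˡ a)) , (λ a → reflexive (ℤ.+-inverseʳ a))
        ; ⁻¹-cong = λ {a b} p → subst (+ m ∣_) (diff-neg a b) (∣m⇒∣-m p)
        }
      ; comm = λ a b → reflexive (ℤ.+-comm a b)
      }
    }

-- The i-th triangle has vertices centre, left i and right i.
data FriendshipVertex (n : ℕ) : Set where
  centre     : FriendshipVertex n
  left right : Fin n → FriendshipVertex n

module _ (n : ℕ) where

  outer : Fin n → List (FriendshipVertex n)
  outer i = left i ∷ right i ∷ []

  triangle : Fin n → List (FriendshipVertex n × FriendshipVertex n)
  triangle i = (centre , left i) ∷ (centre , right i) ∷ (left i , right i) ∷ []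

  private
    V = FriendshipVertex n

    outer-in : ∀ i {v} → v ∈ outer i → v ∈ concat (tabulate outer)
    outer-in i p = ∈-concat⁺′ p (∈-tabulate⁺ i)

    all-vertices : ∀ v → v ∈ centre ∷ concat (tabulate outer)
    all-vertices centre    = here refl
    all-vertices (left i)  = there (outer-in i (here refl))
    all-vertices (right i) = there (outer-in i (there (here refl)))

    unique-vertices : Unique (centre ∷ concat (tabulate outer))
    unique-vertices =
      All.concat⁺ (All.tabulate⁺ {f = outer} (λ i → (λ ()) ∷ (λ ()) ∷ [])) ∷
      AllPairs.concat⁺
        (All.tabulate⁺ {f = outer} (λ i → ((λ ()) ∷ []) ∷ [] ∷ []))
        (AllPairs.tabulate⁺ {f = outer} (λ i≢j →
          ((λ { refl → i≢j refl }) ∷ (λ ()) ∷ []) ∷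
          ((λ ()) ∷ (λ { refl → i≢j refl }) ∷ []) ∷ []))

    loopless : All (λ (u , v) → u ≢ v) (concat (tabulate triangle))
    loopless = All.concat⁺ (All.tabulate⁺ {f = triangle} (λ i → (λ ()) ∷ (λ ()) ∷ (λ ()) ∷ []))

    unique-edges : AllPairs (λ e f → ¬ SamePair e f) (concat (tabulate triangle))
    unique-edges = AllPairs.concat⁺
      (All.tabulate⁺ {f = triangle} (λ i →
        (no₁ ∷ no₂ ∷ []) ∷ (no₃ ∷ []) ∷ [] ∷ []))
      (AllPairs.tabulate⁺ {f = triangle} (λ i≢j →
        ((λ { (inj₁ (_ , refl)) → i≢j refl ; (inj₂ (() , _)) }) ∷ no₁ ∷ no₂ ∷ []) ∷
        (no₄ ∷ (λ { (inj₁ (_ , refl)) → i≢j refl ; (inj₂ (() , _)) }) ∷ no₃ ∷ []) ∷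
        (no₅ ∷ no₆ ∷ (λ { (inj₁ (refl , _)) → i≢j refl ; (inj₂ (() , _)) }) ∷ []) ∷ []))
      where
      no₁ : ∀ {i j : Fin n} → ¬ SamePair {V} (centre , left i) (centre , right j)
      no₁ (inj₁ (_ , ()))
      no₁ (inj₂ (() , _))
      no₂ : ∀ {i j : Fin n} → ¬ SamePair {V} (centre , left i) (left j , right j)
      no₂ (inj₁ (() , _))
      no₂ (inj₂ (() , _))
      no₃ : ∀ {i j : Fin n} → ¬ SamePair {V} (centre , right i) (left j , right j)
      no₃ (inj₁ (() , _))
      no₃ (inj₂ (() , _))
      no₄ : ∀ {i j : Fin n} → ¬ SamePair {V} (centre , right i) (centre , left j)
      no₄ (inj₁ (_ , ()))
      no₄ (inj₂ (() , _))
      no₅ : ∀ {i j : Fin n} → ¬ SamePair {V} (left i , right i) (centre , left j)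
      no₅ (inj₁ (() , _))
      no₅ (inj₂ (_ , ()))
      no₆ : ∀ {i j : Fin n} → ¬ SamePair {V} (left i , right i) (centre , right j)
      no₆ (inj₁ (() , _))
      no₆ (inj₂ (() , _))

  friendship : Graph
  friendship = record
    { Vertex          = V
    ; vertices        = centre ∷ concat (tabulate outer)
    ; vertices-all    = all-vertices
    ; vertices-unique = unique-vertices
    ; edges           = concat (tabulate triangle)
    ; edges-loopless  = loopless
    ; edges-unique    = unique-edges
    }

{-# OPTIONS --safe #-}
-- The centre gets 0, the triangles get the pairs {n, n-1} and {-n, 1-n} for
-- n = k, k-2, …, closing with {1, -1}, or with {1, -1} and {2, -2}.  The labels
-- then run through -k, …, k, once each.  Spokes carry the nonzero labels; an
-- outer edge carries 0 or some t + (1 + t).  As 2 is invertible modulo 2k + 1,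
-- distinct t in -k, …, k give distinct sums, and t = k, which never occurs,
-- gives 0.  Hence every edge label occurs once or twice when k ≥ 1.
module Submission where

open import Defs
open import Data.Bool.Base using (if_then_else_)
open import Data.Fin.Base using (Fin; zero; suc)
open import Data.Integer.Base as ℤ using (ℤ; +_; -[1+_]; 0ℤ; 1ℤ)
open import Data.Integer.Divisibility.Signed using
  ( _∣_; divides; ∣-refl; ∣m∣n⇒∣m+n; ∣m∣n⇒∣m-n; ∣m⇒∣m*n; ∣n⇒∣m*n; ∣⇒∣ᵤ )
import Data.Integer.Properties as ℤ
import Data.Integer.Tactic.RingSolver as ℤ-Solver
open import Data.List.Base using (List; []; _∷_; _++_; concat; filter; length; tabulate)
open import Data.List.Properties using (filter-++; length-++; tabulate-cong)
open import Data.Nat.Base using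
  ( ℕ; zero; suc; _+_; _*_; ⌊_/2⌋; _≤_; _<_; z≤n; s≤s; ∣_-_∣ )
import Data.Nat.Divisibility as ℕ
open import Data.Nat.ListAction using (sum)
open import Data.Nat.Properties using
  ( +-assoc; +-cancelˡ-≡; +-cancelˡ-≤; +-comm; +-identityʳ; +-monoʳ-≤
  ; +-suc; ≤-refl; ≤-trans; m≤m+n; m≤n+m; n≡⌈n+n/2⌉
  ; module ≤-Reasoning )
import Data.Nat.Tactic.RingSolver as ℕ-Solver
open import Data.Product.Base using (_×_; _,_; proj₁; proj₂; uncurry)
open import Function.Base using (_∘_)
open import Function.Bundles using (_⇔_; mk⇔)
open import Level using (Level)
open import Relation.Binary.PropositionalEquality
  using (_≡_; refl; sym; trans; cong; cong₂; subst; module ≡-Reasoning)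
open import Relation.Nullary.Decidable using (Dec; does; yes; no; does-⇔; dec-true; dec-false)
open import Relation.Nullary.Negation using (¬_)
open import Relation.Unary using (Pred; Decidable)

-- Counting by sums of 0/1 values.

private variable
  a p : Level
  A : Set a

𝟙 : Dec A → ℕ
𝟙 a? = if does a? then 1 else 0

module _ {P : Pred A p} (P? : Decidable P) where

  length-filter-∷ : ∀ x xs → length (filter P? (x ∷ xs)) ≡ 𝟙 (P? x) + length (filter P? xs)
  length-filter-∷ x xs with P? x
  ... | yes _ = refl
  ... | no  _ = refl

  length-filter-concat-tabulate : ∀ n (f : Fin n → List A) →
    length (filter P? (concat (tabulate f))) ≡ sum (tabulate (length ∘ filter P? ∘ f))
  length-filter-concat-tabulate zero    f = refl
  length-filter-concat-tabulate (suc n) f = begin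
    length (filter P? (f zero ++ concat (tabulate (f ∘ suc))))
      ≡⟨ cong length (filter-++ P? (f zero) _) ⟩
    length (filter P? (f zero) ++ filter P? (concat (tabulate (f ∘ suc))))
      ≡⟨ length-++ (filter P? (f zero)) ⟩
    length (filter P? (f zero)) + length (filter P? (concat (tabulate (f ∘ suc))))
      ≡⟨ cong (_+_ (length (filter P? (f zero)))) (length-filter-concat-tabulate n (f ∘ suc)) ⟩
    sum (tabulate (length ∘ filter P? ∘ f)) ∎
    where open ≡-Reasoning

sum-tabulate-+ : ∀ n (f g : Fin n → ℕ) →
  sum (tabulate (λ i → f i + g i)) ≡ sum (tabulate f) + sum (tabulate g)
sum-tabulate-+ zero    f g = refl
sum-tabulate-+ (suc n) f g =
  trans (cong (_+_ _) (sum-tabulate-+ n (f ∘ suc) (g ∘ suc)))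
        (interchange (f zero) (g zero) _ _)
  where
  interchange : ∀ a b c d → a + b + (c + d) ≡ a + c + (b + d)
  interchange = ℕ-Solver.solve-∀

-- Sums of a function over consecutive integers.

module _ (χ : ℤ → ℕ) where

  window : ℤ → ℕ → ℕ
  window z zero    = 0
  window z (suc n) = χ z + window (z ℤ.+ 1ℤ) n

  -- Sum over -k, ..., k, built outwards from 0, so that unfolding it removes the outermost labels
  -- first, as `outerLabels` does.
  symmetricSum : ℕ → ℕ
  symmetricSum zero    = χ 0ℤ
  symmetricSum (suc k) = χ (+ suc k) + (χ -[1+ k ] + symmetricSum k)

  window-snoc : ∀ z n → window z (suc n) ≡ window z n + χ (z ℤ.+ + n)
  window-snoc z zero    = trans (+-identityʳ (χ z)) (cong χ (sym (ℤ.+-identityʳ z)))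
  window-snoc z (suc n) = begin
    χ z + window (z ℤ.+ 1ℤ) (suc n)
      ≡⟨ cong (_+_ (χ z)) (window-snoc (z ℤ.+ 1ℤ) n) ⟩
    χ z + (window (z ℤ.+ 1ℤ) n + χ (z ℤ.+ 1ℤ ℤ.+ + n))
      ≡⟨ sym (+-assoc (χ z) _ _) ⟩
    window z (suc n) + χ (z ℤ.+ 1ℤ ℤ.+ + n)
      ≡⟨ cong (λ w → window z (suc n) + χ w) (ℤ.+-assoc z 1ℤ (+ n)) ⟩
    window z (suc n) + χ (z ℤ.+ + suc n) ∎
    where open ≡-Reasoning

  -- Passes to consecutive order, where periodicity applies. Each step adds one term at both ends:
  -- the front one by definition of `window`, the back one by `window-snoc`.
  symmetricSum≡window : ∀ k → symmetricSum k ≡ window (ℤ.- + k) (suc (k + k))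
  symmetricSum≡window zero    = sym (+-identityʳ (χ 0ℤ))
  symmetricSum≡window (suc k) = begin
    χ (+ suc k) + (χ -[1+ k ] + symmetricSum k)
      ≡⟨ cong (λ w → χ (+ suc k) + (χ -[1+ k ] + w)) (symmetricSum≡window k) ⟩
    χ (+ suc k) + (χ -[1+ k ] + window (ℤ.- + k) (suc (k + k)))
      ≡⟨ cong (λ w → χ (+ suc k) + (χ -[1+ k ] + window w (suc (k + k)))) (sym start) ⟩
    χ (+ suc k) + window -[1+ k ] (suc (suc (k + k)))
      ≡⟨ +-comm (χ (+ suc k)) _ ⟩
    window -[1+ k ] (suc (suc (k + k))) + χ (+ suc k)
      ≡⟨ cong (λ w → window -[1+ k ] (suc (suc (k + k))) + χ w) (sym stop) ⟩
    window -[1+ k ] (suc (suc (k + k))) + χ (-[1+ k ] ℤ.+ + suc (suc (k + k)))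
      ≡⟨ sym (window-snoc -[1+ k ] (suc (suc (k + k)))) ⟩
    window -[1+ k ] (suc (suc (suc (k + k))))
      ≡⟨ cong (λ n → window -[1+ k ] (suc (suc n))) (sym (+-suc k k)) ⟩
    window -[1+ k ] (suc (suc k + suc k)) ∎
    where
    open ≡-Reasoning
    start : -[1+ k ] ℤ.+ 1ℤ ≡ ℤ.- + k
    start = trans (ℤ.+-comm -[1+ k ] 1ℤ) (1-suc k)
      where
      1-suc : ∀ k → 1ℤ ℤ.+ -[1+ k ] ≡ ℤ.- + k
      1-suc zero    = refl
      1-suc (suc k) = refl
    stop : -[1+ k ] ℤ.+ + suc (suc (k + k)) ≡ + suc k
    stop = rearrange (+ k)
      where
      rearrange : ∀ x → ℤ.- (1ℤ ℤ.+ x) ℤ.+ (+ 2 ℤ.+ (x ℤ.+ x)) ≡ 1ℤ ℤ.+ x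
      rearrange = ℤ-Solver.solve-∀

  window-zero : ∀ z n → (∀ i → i < n → χ (z ℤ.+ + i) ≡ 0) → window z n ≡ 0
  window-zero z zero    χ≡0 = refl
  window-zero z (suc n) χ≡0 = cong₂ _+_
    (trans (cong χ (sym (ℤ.+-identityʳ z))) (χ≡0 0 (s≤s z≤n)))
    (window-zero (z ℤ.+ 1ℤ) n λ i i<n →
      trans (cong χ (ℤ.+-assoc z 1ℤ (+ i))) (χ≡0 (suc i) (s≤s i<n)))

  module _ (m : ℕ) (periodic : ∀ z → χ (z ℤ.+ + m) ≡ χ z) where

    -- Both windows arise from `window z (suc m)`, by dropping its first or its last term; these two
    -- agree by periodicity.
    window-suc : ∀ z → window (z ℤ.+ 1ℤ) m ≡ window z m
    window-suc z = +-cancelˡ-≡ (χ z) _ _ (begin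
      window z (suc m)           ≡⟨ window-snoc z m ⟩
      window z m + χ (z ℤ.+ + m) ≡⟨ cong (_+_ (window z m)) (periodic z) ⟩
      window z m + χ z           ≡⟨ +-comm (window z m) (χ z) ⟩
      χ z + window z m           ∎)
      where open ≡-Reasoning

    window-+ : ∀ z n → window (z ℤ.+ + n) m ≡ window z m
    window-+ z zero    = cong (λ w → window w m) (ℤ.+-identityʳ z)
    window-+ z (suc n) = begin
      window (z ℤ.+ (1ℤ ℤ.+ + n)) m ≡⟨ cong (λ w → window w m) (sym (ℤ.+-assoc z 1ℤ (+ n))) ⟩
      window (z ℤ.+ 1ℤ ℤ.+ + n) m   ≡⟨ window-+ (z ℤ.+ 1ℤ) n ⟩
      window (z ℤ.+ 1ℤ) m           ≡⟨ window-suc z ⟩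
      window z m                    ∎
      where open ≡-Reasoning

    -- One of `y`, `z` is reached from the other by finitely many steps to the right, so the sign of
    -- the difference decides the direction.
    window-shift : ∀ y z → window y m ≡ window z m
    window-shift y z with y ℤ.- z in eq
    ... | + n      = trans (cong (λ w → window w m) (sym z+n≡y)) (window-+ z n)
      where
      cancel : ∀ y z → z ℤ.+ (y ℤ.- z) ≡ y
      cancel = ℤ-Solver.solve-∀
      z+n≡y : z ℤ.+ + n ≡ y
      z+n≡y = trans (cong (ℤ._+_ z) (sym eq)) (cancel y z)
    ... | -[1+ n ] = sym (trans (cong (λ w → window w m) (sym y+n≡z)) (window-+ y (suc n)))
      where
      cancel : ∀ y z → y ℤ.+ ℤ.- (y ℤ.- z) ≡ z
      cancel = ℤ-Solver.solve-∀
      y+n≡z : y ℤ.+ + suc n ≡ z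
      y+n≡z = trans (cong (λ w → y ℤ.+ ℤ.- w) (sym eq)) (cancel y z)

-- Residue classes and full residue systems.

indicator : ℕ → ℤ → ℤ → ℕ
indicator m a x = 𝟙 (_≡ₘ?_ m x a)

indicator-⇔ : ∀ m a b x y → (_≡ₘ_ m x a) ⇔ (_≡ₘ_ m y b) → indicator m a x ≡ indicator m b y
indicator-⇔ m a b x y x≡a⇔y≡b =
  cong (if_then 1 else 0) (does-⇔ x≡a⇔y≡b (_≡ₘ?_ m x a) (_≡ₘ?_ m y b))

indicator-true : ∀ m a x → _≡ₘ_ m x a → indicator m a x ≡ 1
indicator-true m a x x≡a = cong (if_then 1 else 0) (dec-true (_≡ₘ?_ m x a) x≡a)

indicator-false : ∀ m a x → ¬ _≡ₘ_ m x a → indicator m a x ≡ 0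
indicator-false m a x x≢a = cong (if_then 1 else 0) (dec-false (_≡ₘ?_ m x a) x≢a)

indicator-+m : ∀ m a x → indicator m a (x ℤ.+ + m) ≡ indicator m a x
indicator-+m m a x = indicator-⇔ m a a (x ℤ.+ + m) x (mk⇔
  (λ d → subst (+ m ∣_) (remove (+ m) a x) (∣m∣n⇒∣m-n d ∣-refl))
  (λ d → subst (+ m ∣_) (add (+ m) a x) (∣m∣n⇒∣m+n d ∣-refl)))
  where
  remove : ∀ m a x → (x ℤ.+ m ℤ.- a) ℤ.- m ≡ x ℤ.- a
  remove = ℤ-Solver.solve-∀
  add : ∀ m a x → (x ℤ.- a) ℤ.+ m ≡ x ℤ.+ m ℤ.- a
  add = ℤ-Solver.solve-∀

-- The window covers a full period, so it may be moved to start at `a`; then its first term is 1 and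
-- all others vanish.
window-indicator : ∀ n a z → window (indicator (suc n) a) z (suc n) ≡ 1
window-indicator n a z = begin
  window χ z (suc n)              ≡⟨ window-shift χ (suc n) (indicator-+m (suc n) a) z a ⟩
  χ a + window χ (a ℤ.+ 1ℤ) n     ≡⟨ cong₂ _+_ (indicator-true (suc n) a a a≡a) rest≡0 ⟩
  1                               ∎
  where
  open ≡-Reasoning
  χ : ℤ → ℕ
  χ = indicator (suc n) a
  a≡a : _≡ₘ_ (suc n) a a
  a≡a = divides 0ℤ (ℤ.+-inverseʳ a)
  cancel : ∀ a i → a ℤ.+ 1ℤ ℤ.+ i ℤ.- a ≡ 1ℤ ℤ.+ i
  cancel = ℤ-Solver.solve-∀
  rest≡0 : window χ (a ℤ.+ 1ℤ) n ≡ 0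
  -- The remaining points differ from `a` by 1, ..., `n`, and none of these is a multiple of
  -- `suc n`.
  rest≡0 = window-zero χ (a ℤ.+ 1ℤ) n λ i i<n → indicator-false (suc n) a (a ℤ.+ 1ℤ ℤ.+ + i) λ d →
    ℕ.>⇒∤ (s≤s i<n) (∣⇒∣ᵤ (subst (+ suc n ∣_) (cancel a (+ i)) d))

odd-suc : ∀ k → 2 * k + 1 ≡ suc (k + k)
odd-suc = ℕ-Solver.solve-∀

symmetricSum-indicator : ∀ k a → symmetricSum (indicator (2 * k + 1) a) k ≡ 1
-- The rewrite gives the modulus the form `suc n` of `window-indicator`, with `n` = `k + k`.
symmetricSum-indicator k a rewrite odd-suc k =
  trans (symmetricSum≡window (indicator (suc (k + k)) a) k) (window-indicator (k + k) a (ℤ.- + k))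

symmetricSum-cong : ∀ {χ ψ : ℤ → ℕ} → (∀ x → χ x ≡ ψ x) → ∀ k → symmetricSum χ k ≡ symmetricSum ψ k
symmetricSum-cong χ≗ψ zero    = χ≗ψ 0ℤ
symmetricSum-cong χ≗ψ (suc k) =
  cong₂ _+_ (χ≗ψ (+ suc k)) (cong₂ _+_ (χ≗ψ -[1+ k ]) (symmetricSum-cong χ≗ψ k))

-- The label 2t + 1 of an edge between labels t and 1 + t, left as a sum so that the sums of pairs
-- in `outerLabels` reduce to it.
odd : ℤ → ℤ
odd t = t ℤ.+ (1ℤ ℤ.+ t)

-- k + 1 is the inverse of 2 modulo 2k + 1.
indicator-odd : ∀ k a t →
  indicator (2 * k + 1) a (odd t) ≡ indicator (2 * k + 1) ((1ℤ ℤ.+ + k) ℤ.* (a ℤ.- 1ℤ)) t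
indicator-odd k a t = indicator-⇔ (2 * k + 1) a _ (odd t) t (mk⇔
  (λ d → subst (+ (2 * k + 1) ∣_) (halve m≡)
    (∣m∣n⇒∣m-n (∣n⇒∣m*n (1ℤ ℤ.+ + k) d) (∣m⇒∣m*n t ∣-refl)))
  (λ d → subst (+ (2 * k + 1) ∣_) (double m≡)
    (∣m∣n⇒∣m+n (∣n⇒∣m*n (+ 2) d) (∣m⇒∣m*n (a ℤ.- 1ℤ) ∣-refl))))
  where
  m≡ : + (2 * k + 1) ≡ 1ℤ ℤ.+ (+ k ℤ.+ + k)
  m≡ = cong +_ (odd-suc k)
  halve′ : ∀ k a t →
    (1ℤ ℤ.+ k) ℤ.* (t ℤ.+ (1ℤ ℤ.+ t) ℤ.- a) ℤ.- (1ℤ ℤ.+ (k ℤ.+ k)) ℤ.* t ≡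
    t ℤ.- (1ℤ ℤ.+ k) ℤ.* (a ℤ.- 1ℤ)
  halve′ = ℤ-Solver.solve-∀
  double′ : ∀ k a t →
    + 2 ℤ.* (t ℤ.- (1ℤ ℤ.+ k) ℤ.* (a ℤ.- 1ℤ)) ℤ.+ (1ℤ ℤ.+ (k ℤ.+ k)) ℤ.* (a ℤ.- 1ℤ) ≡
    t ℤ.+ (1ℤ ℤ.+ t) ℤ.- a
  double′ = ℤ-Solver.solve-∀
  -- The modulus is a variable here, so that the equation for it can be matched with `refl`.
  halve : ∀ {m} → m ≡ 1ℤ ℤ.+ (+ k ℤ.+ + k) →
    (1ℤ ℤ.+ + k) ℤ.* (odd t ℤ.- a) ℤ.- m ℤ.* t ≡ t ℤ.- (1ℤ ℤ.+ + k) ℤ.* (a ℤ.- 1ℤ)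
  halve refl = halve′ (+ k) a t
  double : ∀ {m} → m ≡ 1ℤ ℤ.+ (+ k ℤ.+ + k) →
    + 2 ℤ.* (t ℤ.- (1ℤ ℤ.+ + k) ℤ.* (a ℤ.- 1ℤ)) ℤ.+ m ℤ.* (a ℤ.- 1ℤ) ≡ odd t ℤ.- a
  double refl = double′ (+ k) a t

-- The map t ↦ 2t + 1 permutes the residues, so `a` has exactly one preimage among -k, ..., k.
symmetricSum-odd : ∀ k a → symmetricSum (indicator (2 * k + 1) a ∘ odd) k ≡ 1
symmetricSum-odd k a =
  trans (symmetricSum-cong (indicator-odd k a) k) (symmetricSum-indicator k _)

-- `odd (+ k)` is the modulus itself.
indicator-odd-k : ∀ k a → indicator (2 * k + 1) a (odd (+ k)) ≡ indicator (2 * k + 1) a 0ℤ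
indicator-odd-k k a = trans
  (cong (indicator (2 * k + 1) a ∘ +_) (trans (+-suc k k) (sym (odd-suc k))))
  (indicator-+m (2 * k + 1) a 0ℤ)

-- Labels of the triangles and the sums over them.

outerLabels : ∀ k → Fin k → ℤ × ℤ
outerLabels 1 zero                            = + 1 , -[1+ 0 ]
outerLabels 2 zero                            = + 1 , -[1+ 0 ]
outerLabels 2 (suc zero)                      = + 2 , -[1+ 1 ]
outerLabels (suc (suc (suc k))) zero          = + (2 + k) , + (3 + k)
-- The smaller entry comes first, as in the positive pair, so that this sum too is `odd` of the
-- first entry.
outerLabels (suc (suc (suc k))) (suc zero)    = -[1+ 2 + k ] , -[1+ 1 + k ]
outerLabels (suc (suc (suc k))) (suc (suc i)) = outerLabels (suc k) i

module _ (χ : ℤ → ℕ) where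

  vertexSum : ℕ → ℕ
  vertexSum k = sum (tabulate (uncurry (λ x y → χ x + χ y) ∘ outerLabels k))

  outerEdgeSum : ℕ → ℕ
  outerEdgeSum k = sum (tabulate (χ ∘ uncurry ℤ._+_ ∘ outerLabels k))

  -- The first two triangles use up the two outermost layers of -k, ..., k, and the rest is the same
  -- problem for k - 2. The term `χ 0ℤ` belongs to the centre.
  vertexSum≡symmetricSum : ∀ k → χ 0ℤ + vertexSum k ≡ symmetricSum χ k
  vertexSum≡symmetricSum 0 = +-identityʳ (χ 0ℤ)
  vertexSum≡symmetricSum 1 = rearrange (χ (+ 1)) (χ -[1+ 0 ]) (χ 0ℤ)
    where
    rearrange : ∀ a b z → z + (a + b + 0) ≡ a + (b + z)
    rearrange = ℕ-Solver.solve-∀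
  vertexSum≡symmetricSum 2 = rearrange (χ (+ 1)) (χ -[1+ 0 ]) (χ (+ 2)) (χ -[1+ 1 ]) (χ 0ℤ)
    where
    rearrange : ∀ a b c d z → z + (a + b + (c + d + 0)) ≡ c + (d + (a + (b + z)))
    rearrange = ℕ-Solver.solve-∀
  vertexSum≡symmetricSum (suc (suc (suc k))) = trans
    (rearrange (χ (+ (2 + k))) (χ (+ (3 + k))) (χ -[1+ 2 + k ]) (χ -[1+ 1 + k ]) (χ 0ℤ) (vertexSum (suc k)))
    (cong (λ s → χ (+ (3 + k)) + (χ -[1+ 2 + k ] + (χ (+ (2 + k)) + (χ -[1+ 1 + k ] + s))))
          (vertexSum≡symmetricSum (suc k)))
    where
    rearrange : ∀ a b c d z s → z + (a + b + (c + d + s)) ≡ b + (c + (a + (d + (z + s))))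
    rearrange = ℕ-Solver.solve-∀

  -- The recursion always ends at the triangle {1, -1}, whose outer edge has label 0, the one label
  -- that no spoke carries.
  χ0≤outerEdgeSum : ∀ k → χ 0ℤ ≤ outerEdgeSum (suc k)
  χ0≤outerEdgeSum 0             = m≤m+n (χ 0ℤ) _
  χ0≤outerEdgeSum 1             = m≤m+n (χ 0ℤ) _
  χ0≤outerEdgeSum (suc (suc k)) =
    ≤-trans (χ0≤outerEdgeSum k) (≤-trans (m≤n+m s (χ (odd -[1+ 2 + k ]))) (m≤n+m _ (χ (odd (+ (2 + k))))))
    where
    s : ℕ
    s = outerEdgeSum (suc k)

  -- The triangles on {n, n-1} and {-n, 1-n} have outer edges odd (n - 1) and
  -- odd (- n); as n ≤ k, odd k is not among them.
  outerEdgeSum-bound : ∀ k →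
    outerEdgeSum k + χ (odd (+ k)) ≤ χ 0ℤ + χ 0ℤ + symmetricSum (χ ∘ odd) k
  outerEdgeSum-bound 0 = m≤n+m _ (χ 0ℤ + χ 0ℤ)
  outerEdgeSum-bound 1 = begin
    χ 0ℤ + 0 + θ (+ 1)
      ≤⟨ m≤m+n _ _ ⟩
    χ 0ℤ + 0 + θ (+ 1) + (χ 0ℤ + (θ -[1+ 0 ] + θ 0ℤ))
      ≡⟨ rearrange (χ 0ℤ) (θ (+ 1)) (θ -[1+ 0 ]) (θ 0ℤ) ⟩
    χ 0ℤ + χ 0ℤ + symmetricSum θ 1 ∎
    where
    open ≤-Reasoning
    θ : ℤ → ℕ
    θ = χ ∘ odd
    rearrange : ∀ z a b c → z + 0 + a + (z + (b + c)) ≡ z + z + (a + (b + c))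
    rearrange = ℕ-Solver.solve-∀
  -- With two closing triangles, both copies of `χ 0ℤ` on the right are used.
  outerEdgeSum-bound 2 = begin
    χ 0ℤ + (χ 0ℤ + 0) + θ (+ 2)
      ≤⟨ m≤m+n _ _ ⟩
    χ 0ℤ + (χ 0ℤ + 0) + θ (+ 2) + (θ -[1+ 1 ] + symmetricSum θ 1)
      ≡⟨ rearrange (χ 0ℤ) (θ (+ 2)) _ ⟩
    χ 0ℤ + χ 0ℤ + symmetricSum θ 2 ∎
    where
    open ≤-Reasoning
    θ : ℤ → ℕ
    θ = χ ∘ odd
    rearrange : ∀ z a b → z + (z + 0) + a + b ≡ z + z + (a + b)
    rearrange = ℕ-Solver.solve-∀
  outerEdgeSum-bound (suc (suc (suc k))) = begin
    θ (+ (2 + k)) + (θ -[1+ 2 + k ] + s) + θ (+ (3 + k))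
      ≡⟨ rearrange₁ (θ (+ (2 + k))) (θ -[1+ 2 + k ]) s (θ (+ (3 + k))) ⟩
    θ (+ (3 + k)) + (θ -[1+ 2 + k ] + θ (+ (2 + k))) + s
      ≤⟨ +-monoʳ-≤ (θ (+ (3 + k)) + (θ -[1+ 2 + k ] + θ (+ (2 + k))))
           -- The induction hypothesis also bounds `θ (+ suc k)`; that term is discarded.
           (≤-trans (m≤m+n s _) (outerEdgeSum-bound (suc k))) ⟩
    θ (+ (3 + k)) + (θ -[1+ 2 + k ] + θ (+ (2 + k))) + (χ 0ℤ + χ 0ℤ + symmetricSum θ (suc k))
      -- No triangle uses t = -(k + 2); its term is added only to complete the symmetric sum.
      ≤⟨ m≤m+n _ (θ -[1+ 1 + k ]) ⟩
    θ (+ (3 + k)) + (θ -[1+ 2 + k ] + θ (+ (2 + k))) + (χ 0ℤ + χ 0ℤ + symmetricSum θ (suc k))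
      + θ -[1+ 1 + k ]
      ≡⟨ rearrange₂ (θ (+ (3 + k))) (θ -[1+ 2 + k ]) (θ (+ (2 + k))) (θ -[1+ 1 + k ]) (χ 0ℤ) _ ⟩
    χ 0ℤ + χ 0ℤ + symmetricSum θ (3 + k) ∎
    where
    open ≤-Reasoning
    θ : ℤ → ℕ
    θ = χ ∘ odd
    s : ℕ
    s = outerEdgeSum (suc k)
    rearrange₁ : ∀ a b s c → a + (b + s) + c ≡ c + (b + a) + s
    rearrange₁ = ℕ-Solver.solve-∀
    rearrange₂ : ∀ a b c d z s → a + (b + c) + (z + z + s) + d ≡ z + z + (a + (b + (c + (d + s))))
    rearrange₂ = ℕ-Solver.solve-∀

-- The labeling of the friendship graph and its counts.

labeling : ∀ k → FriendshipVertex k → ℤ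
labeling k centre    = 0ℤ
labeling k (left i)  = proj₁ (outerLabels k i)
labeling k (right i) = proj₂ (outerLabels k i)

module _ (m k : ℕ) (a : ℤ) where

  private
    χ : ℤ → ℕ
    χ = indicator m a

  vertexCount-labeling :
    vertexCount (ℤ/ m) (_≡ₘ?_ m) (friendship k) (labeling k) a ≡ symmetricSum χ k
  vertexCount-labeling = begin
    length (filter P? (centre ∷ concat (tabulate (outer k))))
      ≡⟨ length-filter-∷ P? centre _ ⟩
    χ 0ℤ + length (filter P? (concat (tabulate (outer k))))
      ≡⟨ cong (_+_ (χ 0ℤ)) (length-filter-concat-tabulate P? k (outer k)) ⟩
    χ 0ℤ + sum (tabulate (length ∘ filter P? ∘ outer k))
      ≡⟨ cong (λ xs → χ 0ℤ + sum xs) (tabulate-cong count) ⟩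
    χ 0ℤ + vertexSum χ k
      ≡⟨ vertexSum≡symmetricSum χ k ⟩
    symmetricSum χ k ∎
    where
    open ≡-Reasoning
    P? = λ v → _≡ₘ?_ m (labeling k v) a
    count : ∀ i → length (filter P? (outer k i)) ≡ uncurry (λ x y → χ x + χ y) (outerLabels k i)
    count i = trans (length-filter-∷ P? (left i) (right i ∷ []))
      (cong (_+_ (χ (labeling k (left i))))
        (trans (length-filter-∷ P? (right i) []) (+-identityʳ _)))

  -- As the centre has label 0, each spoke repeats its outer label. The extra `χ 0ℤ` on the left
  -- completes these labels to -k, ..., k without a subtraction.
  edgeCount-labeling :
    χ 0ℤ + edgeCount (ℤ/ m) (_≡ₘ?_ m) (friendship k) (labeling k) a
      ≡ symmetricSum χ k + outerEdgeSum χ k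
  edgeCount-labeling = begin
    χ 0ℤ + length (filter P? (concat (tabulate (triangle k))))
      ≡⟨ cong (_+_ (χ 0ℤ)) (length-filter-concat-tabulate P? k (triangle k)) ⟩
    χ 0ℤ + sum (tabulate (length ∘ filter P? ∘ triangle k))
      ≡⟨ cong (λ xs → χ 0ℤ + sum xs) (tabulate-cong count) ⟩
    χ 0ℤ + sum (tabulate (λ i → uncurry (λ x y → χ x + χ y) (outerLabels k i) + χ (uncurry ℤ._+_ (outerLabels k i))))
      ≡⟨ cong (_+_ (χ 0ℤ)) (sum-tabulate-+ k _ _) ⟩
    χ 0ℤ + (vertexSum χ k + outerEdgeSum χ k)
      ≡⟨ sym (+-assoc (χ 0ℤ) _ _) ⟩
    χ 0ℤ + vertexSum χ k + outerEdgeSum χ k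
      ≡⟨ cong (_+ outerEdgeSum χ k) (vertexSum≡symmetricSum χ k) ⟩
    symmetricSum χ k + outerEdgeSum χ k ∎
    where
    open ≡-Reasoning
    P? = λ e → _≡ₘ?_ m (edgeLabel (ℤ/ m) (_≡ₘ?_ m) (friendship k) (labeling k) e) a
    count : ∀ i → length (filter P? (triangle k i)) ≡
      uncurry (λ x y → χ x + χ y) (outerLabels k i) + χ (uncurry ℤ._+_ (outerLabels k i))
    count i = begin
      length (filter P? (triangle k i))
        ≡⟨ length-filter-∷ P? (centre , left i) _ ⟩
      χ (0ℤ ℤ.+ x) + length (filter P? ((centre , right i) ∷ (left i , right i) ∷ []))
        ≡⟨ cong (_+_ (χ (0ℤ ℤ.+ x))) (length-filter-∷ P? (centre , right i) _) ⟩
      χ (0ℤ ℤ.+ x) + (χ (0ℤ ℤ.+ y) + length (filter P? ((left i , right i) ∷ [])))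
        ≡⟨ cong (λ n → χ (0ℤ ℤ.+ x) + (χ (0ℤ ℤ.+ y) + n))
             (trans (length-filter-∷ P? (left i , right i) []) (+-identityʳ _)) ⟩
      χ (0ℤ ℤ.+ x) + (χ (0ℤ ℤ.+ y) + χ (x ℤ.+ y))
        ≡⟨ cong₂ (λ u v → χ u + (χ v + χ (x ℤ.+ y))) (ℤ.+-identityˡ x) (ℤ.+-identityˡ y) ⟩
      χ x + (χ y + χ (x ℤ.+ y))
        ≡⟨ sym (+-assoc (χ x) _ _) ⟩
      χ x + χ y + χ (x ℤ.+ y) ∎
      where
      x = labeling k (left i)
      y = labeling k (right i)

vertexCount≡1 : ∀ k a →
  vertexCount (ℤ/ (2 * k + 1)) (_≡ₘ?_ (2 * k + 1)) (friendship k) (labeling k) a ≡ 1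
vertexCount≡1 k a = trans (vertexCount-labeling (2 * k + 1) k a) (symmetricSum-indicator k a)

-- Since `χ 0ℤ + e ≡ 1 + s`, it suffices that `s` lies between `χ 0ℤ` and `χ 0ℤ + 1`. At least one
-- triangle is needed for the lower bound.
edgeCount-bounds : ∀ k a →
  let n = suc k
      e = edgeCount (ℤ/ (2 * n + 1)) (_≡ₘ?_ (2 * n + 1)) (friendship n) (labeling n) a
  in 1 ≤ e × e ≤ 2
edgeCount-bounds k a =
  +-cancelˡ-≤ (χ 0ℤ) _ _ (begin
    χ 0ℤ + 1 ≡⟨ +-comm (χ 0ℤ) 1 ⟩
    1 + χ 0ℤ ≤⟨ s≤s (χ0≤outerEdgeSum χ k) ⟩
    1 + s    ≡⟨ sym χ0+e≡1+s ⟩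
    χ 0ℤ + e ∎) ,
  +-cancelˡ-≤ (χ 0ℤ) _ _ (begin
    χ 0ℤ + e       ≡⟨ χ0+e≡1+s ⟩
    1 + s          ≤⟨ s≤s s≤χ0+1 ⟩
    1 + (χ 0ℤ + 1) ≡⟨ +-comm 1 (χ 0ℤ + 1) ⟩
    χ 0ℤ + 1 + 1   ≡⟨ +-assoc (χ 0ℤ) 1 1 ⟩
    χ 0ℤ + 2       ∎)
  where
  open ≤-Reasoning
  n m e s : ℕ
  n = suc k
  m = 2 * n + 1
  χ : ℤ → ℕ
  χ = indicator m a
  e = edgeCount (ℤ/ m) (_≡ₘ?_ m) (friendship n) (labeling n) a
  s = outerEdgeSum χ n
  χ0+e≡1+s : χ 0ℤ + e ≡ 1 + s
  χ0+e≡1+s = trans (edgeCount-labeling m n a) (cong (_+ s) (symmetricSum-indicator n a))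
  s≤χ0+1 : s ≤ χ 0ℤ + 1
  s≤χ0+1 = +-cancelˡ-≤ (χ 0ℤ) _ _ (begin
    χ 0ℤ + s                                 ≡⟨ +-comm (χ 0ℤ) s ⟩
    s + χ 0ℤ                                 ≡⟨ cong (_+_ s) (sym (indicator-odd-k n a)) ⟩
    s + χ (odd (+ n))                        ≤⟨ outerEdgeSum-bound χ n ⟩
    χ 0ℤ + χ 0ℤ + symmetricSum (χ ∘ odd) n   ≡⟨ cong (_+_ (χ 0ℤ + χ 0ℤ)) (symmetricSum-odd n a) ⟩
    χ 0ℤ + χ 0ℤ + 1                          ≡⟨ +-assoc (χ 0ℤ) (χ 0ℤ) 1 ⟩
    χ 0ℤ + (χ 0ℤ + 1)                        ∎)

-- Balance of the counts.

∣-∣≤1 : ∀ {x y} → 1 ≤ x × x ≤ 2 → 1 ≤ y × y ≤ 2 → ∣ x - y ∣ ≤ 1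
∣-∣≤1 {1} {1} _ _ = z≤n
∣-∣≤1 {1} {2} _ _ = ≤-refl
∣-∣≤1 {2} {1} _ _ = ≤-refl
∣-∣≤1 {2} {2} _ _ = z≤n
∣-∣≤1 {suc (suc (suc _))} (_ , s≤s (s≤s ())) _
∣-∣≤1 {1} {suc (suc (suc _))} _ (_ , s≤s (s≤s ()))
∣-∣≤1 {2} {suc (suc (suc _))} _ (_ , s≤s (s≤s ()))

edgeCount-balanced : ∀ k a₁ a₂ →
  let count = edgeCount (ℤ/ (2 * k + 1)) (_≡ₘ?_ (2 * k + 1)) (friendship k) (labeling k)
  in ∣ count a₁ - count a₂ ∣ ≤ 1
-- Without triangles there are no edges, and all counts are 0.
edgeCount-balanced zero    a₁ a₂ = z≤n
edgeCount-balanced (suc k) a₁ a₂ = ∣-∣≤1 (edgeCount-bounds k a₁) (edgeCount-bounds k a₂)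

labeling-isCordial : ∀ k →
  IsCordialLabeling (ℤ/ (2 * k + 1)) (_≡ₘ?_ (2 * k + 1)) (friendship k) (labeling k)
labeling-isCordial k = record
  { vertices-balanced = λ a₁ a₂ → ∣-∣≤1 (vertexCount-bounds a₁) (vertexCount-bounds a₂)
  ; edges-balanced    = edgeCount-balanced k
  }
  where
  vertexCount-bounds : ∀ a →
    let v = vertexCount (ℤ/ (2 * k + 1)) (_≡ₘ?_ (2 * k + 1)) (friendship k) (labeling k) a
    in 1 ≤ v × v ≤ 2
  vertexCount-bounds a rewrite vertexCount≡1 k a = s≤s z≤n , s≤s z≤n

theorem11p1 : (m k : ℕ) → m ≡ 2 * k + 1 →
    ⌊ m /2⌋ ≡ k × Cordial (ℤ/ m) (_≡ₘ?_ m) (friendship k)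
theorem11p1 _ k refl =
  -- By definition `⌊ suc n /2⌋` is `⌈ n /2⌉`, hence the ceiling lemma at `k + k`.
  trans (cong ⌊_/2⌋ (odd-suc k)) (sym (n≡⌈n+n/2⌉ k)) , labeling k , labeling-isCordial k
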